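{- Let $m$ be a positive integer. In each of the following cases the displayed identity holds, and the triple consisting of $n_1=6m+4$ and the denominators $n_2,n_3$ of the second and third unit fractions on the right-hand side is a wild solution of the Erdős–Straus equation for $24m+1$. (1) If $m=10\ell-1+c(30\ell-1)$ with $\ell$ a positive integer and $c\in\mathbb N$, then $$\frac{4}{24m+1}=\frac{1}{6m+4}+\frac{1}{4\ell(3c+1)(24m+1)}+\frac{1}{4\ell(3c+1)(30\ell-1)(24m+1)}.$$ (2) If $m=10\ell+4+c(15\ell+7)$ with $\ell$ a positive integer and $c\in\mathbb N$, then $$\frac{4}{24m+1}=\frac{1}{6m+4}+\frac{1}{(2\ell+1)(3c+2)(24m+1)}+\frac{1}{2(2\ell+1)(3c+2)(15\ell+7)(24m+1)}.$$ (3) If $m=20\ell+8+c(30\ell+13)$ with $\ell$ a positive integer and $c\in\mathbb N$, then $$\frac{4}{24m+1}=\frac{1}{6m+4}+\frac{1}{2(2\ell+1)(3c+2)(24m+1)}+\frac{1}{(2\ell+1)(3c+2)(30\ell+13)(24m+1)}.$$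
   Context: $\mathbb N$ denotes the set of nonnegative integers. For a positive integer $m$, the Erdős–Straus equation for $n=24m+1$ is $\frac{4}{n}=\frac1{n_1}+\frac1{n_2}+\frac1{n_3}$ in positive integers $n_1,n_2,n_3$. For $n_1=6m+k$ with $1\le k\le 12m$ one has $\frac{4}{24m+1}=\frac{1}{6m+k}+\frac{4k-1}{(6m+k)(24m+1)}$. A solution $(n_1,n_2,n_3)$ is called a wild solution if $n_1=6m+k$ for some integer $1\le k\le 12m$ and there exist an integer $L\ge 2$ (called a multiplier) and positive integers $J_1,J_2$ (called the numerator summands) such that $J_1+J_2=L(4k-1)$, $\gcd(L,J_1,J_2)=1$, $\frac1{n_2}=\frac{J_1}{L(6m+k)(24m+1)}$ and $\frac1{n_3}=\frac{J_2}{L(6m+k)(24m+1)}$. -}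

module Defs where

open import Data.Integer.Base using (+_)
open import Data.Nat.Base
  using (ℕ; suc; _+_; _*_; _∸_; _≤_; NonZero; >-nonZero; s≤s; z≤n)
open import Data.Nat.GCD using (gcd)
open import Data.Nat.Properties using (m*n≢0; ≤-trans; m≤n+m)
open import Data.Rational.Base as ℚ using (ℚ; _/_)
open import Relation.Binary.PropositionalEquality.Core using (_≡_)

-- The modulus n = 24m + 1 is written 1 + 24 * m, so that Agda sees it is nonzero.
record ErdősStraus (m n₁ n₂ n₃ : ℕ) : Set where
  field
    {{n₁≢0}} : NonZero n₁
    {{n₂≢0}} : NonZero n₂
    {{n₃≢0}} : NonZero n₃
    equation : + 4 / (1 + 24 * m) ≡ + 1 / n₁ ℚ.+ + 1 / n₂ ℚ.+ + 1 / n₃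

denominator≢0 : ∀ m {k L} → 1 ≤ k → 2 ≤ L →
                NonZero (L * (6 * m + k) * (1 + 24 * m))
denominator≢0 m {k} {L} 1≤k 2≤L =
  m*n≢0 (L * (6 * m + k)) (1 + 24 * m)
    {{m*n≢0 L (6 * m + k)
       {{>-nonZero (≤-trans (s≤s z≤n) 2≤L)}}
       {{>-nonZero (≤-trans 1≤k (m≤n+m k (6 * m)))}}}}

-- The entries are ordered: J₁ belongs to n₂ and J₂ to n₃.
-- The subtraction in 4 * k ∸ 1 is never truncated, because 1 ≤ k.
record WildSolution (m n₁ n₂ n₃ : ℕ) : Set where
  field
    solution   : ErdősStraus m n₁ n₂ n₃
    k          : ℕ
    1≤k        : 1 ≤ k
    k≤12m      : k ≤ 12 * m
    n₁≡6m+k    : n₁ ≡ 6 * m + k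
    multiplier : ℕ
    J₁ J₂      : ℕ

  open ErdősStraus solution public

  field
    2≤L     : 2 ≤ multiplier
    1≤J₁    : 1 ≤ J₁
    1≤J₂    : 1 ≤ J₂
    J₁+J₂   : J₁ + J₂ ≡ multiplier * (4 * k ∸ 1)
    coprime : gcd multiplier (gcd J₁ J₂) ≡ 1
    1/n₂    : + 1 / n₂ ≡ _/_ (+ J₁) (multiplier * (6 * m + k) * (1 + 24 * m))
                             {{denominator≢0 m 1≤k 2≤L}}
    1/n₃    : + 1 / n₃ ≡ _/_ (+ J₂) (multiplier * (6 * m + k) * (1 + 24 * m))
                             {{denominator≢0 m 1≤k 2≤L}}

{-# OPTIONS --safe #-}
module Submission where

-- With L the multiplier, D = L (6m + k) (24m + 1) is a common denominator:
-- 1/n₁ = L (24m + 1) / D, and since J₁ + J₂ = L (4k − 1), the three numerators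
-- add up to L (24m + 4k) = 4 L (6m + k), which is 4/(24m + 1) of D.  In each
-- case 6m + 4 factors as 2 (3c + 1) a or 2 (3c + 2) a with a the modulus
-- occurring in the congruence for m, and then (L, J₁, J₂) is respectively
-- (2ℓ, 30ℓ − 1, 1), (2ℓ + 1, 2 (15ℓ + 7), 1) and (2ℓ + 1, 30ℓ + 13, 2).

open import Data.Integer.Base as ℤ using (+_)
open import Data.Integer.Properties using (pos-*)
open import Data.Nat.Base
  using (ℕ; suc; _+_; _*_; _∸_; _≤_; NonZero; z≤n; s≤s; >-nonZero; >-nonZero⁻¹)
open import Data.Nat.Divisibility using (_∣_; ∣-trans; ∣1⇒≡1; ∣m+n∣m⇒∣n; ∣m⇒∣m*n)
open import Data.Nat.GCD using (gcd; gcd[m,n]∣m; gcd[m,n]∣n; gcd-zeroʳ)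
open import Data.Nat.Properties
open import Data.Nat.Tactic.RingSolver using (solve-∀)
open import Data.Product.Base using (_×_; _,_)
open import Data.Rational.Base as ℚ using (_/_; toℚᵘ; fromℚᵘ)
import Data.Rational.Properties as ℚ
open import Data.Rational.Unnormalised.Base as ℚᵘ using (mkℚᵘ; *≡*)
import Data.Rational.Unnormalised.Properties as ℚᵘ
open import Relation.Binary.PropositionalEquality
open import Defs

-- Matching on `suc` turns both sides into `fromℚᵘ` of unnormalised fractions, whose equality is
-- cross-multiplication, so no gcd has to be computed.
/-cross : ∀ a b c d .{{_ : NonZero b}} .{{_ : NonZero d}} →
          a * d ≡ c * b → + a / b ≡ + c / d
/-cross a (suc b) c (suc d) ad≡cb =
  ℚ.fromℚᵘ-cong {mkℚᵘ (+ a) b} {mkℚᵘ (+ c) d} (*≡*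
    (trans (sym (pos-* a (suc d))) (trans (cong +_ ad≡cb) (pos-* c (suc b)))))

-- Addition in `ℚ` normalises its result; the sum is therefore compared among unnormalised
-- fractions, where its denominator is simply the square of the common one.
/-+ : ∀ a b d .{{_ : NonZero d}} → + a / d ℚ.+ + b / d ≡ + (a + b) / d
/-+ a b (suc d) = ℚ.toℚᵘ-injective (begin
  toℚᵘ (fromℚᵘ p ℚ.+ fromℚᵘ q)            ≈⟨ ℚ.toℚᵘ-homo-+ (fromℚᵘ p) (fromℚᵘ q) ⟩
  toℚᵘ (fromℚᵘ p) ℚᵘ.+ toℚᵘ (fromℚᵘ q)    ≈⟨ ℚᵘ.+-cong (ℚ.toℚᵘ-fromℚᵘ p) (ℚ.toℚᵘ-fromℚᵘ q) ⟩
  p ℚᵘ.+ q                                ≈⟨ *≡* p+q≃r ⟩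
  r                                       ≈⟨ ℚ.toℚᵘ-fromℚᵘ r ⟨
  toℚᵘ (fromℚᵘ r)                         ∎)
  where
  open import Relation.Binary.Reasoning.Setoid ℚᵘ.≃-setoid
  p = mkℚᵘ (+ a) d
  q = mkℚᵘ (+ b) d
  r = mkℚᵘ (+ (a + b)) d
  distrib : ∀ a b e → (a * e + b * e) * e ≡ (a + b) * (e * e)
  distrib = solve-∀
  p+q≃r : (+ a ℤ.* + suc d ℤ.+ + b ℤ.* + suc d) ℤ.* + suc d ≡ + (a + b) ℤ.* + (suc d * suc d)
  -- `pos-*` gathers each side under a single `+_`, leaving an identity in `ℕ` for the ring solver.
  p+q≃r rewrite sym (pos-* a (suc d)) | sym (pos-* b (suc d))
              | sym (pos-* (a * suc d + b * suc d) (suc d))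
              | sym (pos-* (a + b) (suc d * suc d)) = cong +_ (distrib a b (suc d))

-- `A₂` and `A₃` are the cofactors of `J₁` and `J₂` in L (6m + k): cancelling J in J / D leaves 1 /
-- (A (24m + 1)). Each case then has to supply such factorisations.
wildSolution :
  ∀ m k L J₁ J₂ A₂ A₃ → 1 ≤ k → k ≤ 12 * m → 2 ≤ L → 1 ≤ J₁ → 1 ≤ J₂ →
  J₁ + J₂ ≡ L * (4 * k ∸ 1) → gcd L (gcd J₁ J₂) ≡ 1 →
  L * (6 * m + k) ≡ J₁ * A₂ → L * (6 * m + k) ≡ J₂ * A₃ →
  WildSolution m (6 * m + k) (A₂ * (24 * m + 1)) (A₃ * (24 * m + 1))
wildSolution m k L J₁ J₂ A₂ A₃ 1≤k k≤12m 2≤L 1≤J₁ 1≤J₂ J₁+J₂ coprime J₁A₂ J₂A₃ = record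
  { solution = record { equation = equation }
  ; k = k ; 1≤k = 1≤k ; k≤12m = k≤12m ; n₁≡6m+k = refl
  ; multiplier = L ; J₁ = J₁ ; J₂ = J₂
  ; 2≤L = 2≤L ; 1≤J₁ = 1≤J₁ ; 1≤J₂ = 1≤J₂ ; J₁+J₂ = J₁+J₂ ; coprime = coprime
  ; 1/n₂ = 1/n₂ ; 1/n₃ = 1/n₃
  }
  where
  n₁ N D n₂ n₃ : ℕ
  n₁ = 6 * m + k
  N = 1 + 24 * m
  D = L * n₁ * N
  n₂ = A₂ * (24 * m + 1)
  n₃ = A₃ * (24 * m + 1)

  D≡J*n : ∀ J A → L * n₁ ≡ J * A → D ≡ J * (A * (24 * m + 1))
  D≡J*n J A eq = trans (cong₂ _*_ eq (+-comm 1 (24 * m))) (*-assoc J A (24 * m + 1))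

  instance
    D≢0 : NonZero D
    D≢0 = denominator≢0 m 1≤k 2≤L
    n₁≢0 : NonZero n₁
    n₁≢0 = >-nonZero (≤-trans 1≤k (m≤n+m k (6 * m)))
    n₂≢0 : NonZero n₂
    -- `D` is nonzero and equals `J₁ * n₂`.
    n₂≢0 = m*n≢0⇒n≢0 J₁ {{subst NonZero (D≡J*n J₁ A₂ J₁A₂) D≢0}}
    n₃≢0 : NonZero n₃
    n₃≢0 = m*n≢0⇒n≢0 J₂ {{subst NonZero (D≡J*n J₂ A₃ J₂A₃) D≢0}}

  1/n₁ : + 1 / n₁ ≡ + (L * N) / D
  1/n₁ = /-cross 1 n₁ (L * N) D (swap L n₁ N)
    where
    swap : ∀ l x y → 1 * (l * x * y) ≡ l * y * x
    swap = solve-∀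

  1/n₂ : + 1 / n₂ ≡ + J₁ / D
  1/n₂ = /-cross 1 n₂ J₁ D (trans (*-identityˡ D) (D≡J*n J₁ A₂ J₁A₂))

  1/n₃ : + 1 / n₃ ≡ + J₂ / D
  1/n₃ = /-cross 1 n₃ J₂ D (trans (*-identityˡ D) (D≡J*n J₂ A₃ J₂A₃))

  numerators : L * N + J₁ + J₂ ≡ 4 * (L * n₁)
  numerators = begin
    L * N + J₁ + J₂                        ≡⟨ +-assoc (L * N) J₁ J₂ ⟩
    L * N + (J₁ + J₂)                      ≡⟨ cong (λ x → L * N + x) J₁+J₂ ⟩
    L * N + L * (4 * k ∸ 1)                ≡⟨ collect L m (4 * k ∸ 1) ⟩
    -- Since 1 ≤ 4k, the subtraction is exact and adding 1 restores 4k.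
    L * (24 * m + (1 + (4 * k ∸ 1)))       ≡⟨ cong (λ x → L * (24 * m + x)) (m+[n∸m]≡n (*-mono-≤ (m≤m+n 1 3) 1≤k)) ⟩
    L * (24 * m + 4 * k)                   ≡⟨ factor L m k ⟩
    4 * (L * n₁)                           ∎
    where
    open ≡-Reasoning
    collect : ∀ l m x → l * (1 + 24 * m) + l * x ≡ l * (24 * m + (1 + x))
    collect = solve-∀
    factor : ∀ l m k → l * (24 * m + 4 * k) ≡ 4 * (l * (6 * m + k))
    factor = solve-∀

  equation : + 4 / N ≡ + 1 / n₁ ℚ.+ + 1 / n₂ ℚ.+ + 1 / n₃
  equation = begin
    + 4 / N                                    ≡⟨ /-cross 4 N (L * N + J₁ + J₂) D (sym (trans (cong (_* N) numerators) (*-assoc 4 (L * n₁) N))) ⟩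
    + (L * N + J₁ + J₂) / D                    ≡⟨ /-+ (L * N + J₁) J₂ D ⟨
    + (L * N + J₁) / D ℚ.+ + J₂ / D            ≡⟨ cong (ℚ._+ + J₂ / D) (/-+ (L * N) J₁ D) ⟨
    + (L * N) / D ℚ.+ + J₁ / D ℚ.+ + J₂ / D    ≡⟨ cong₂ ℚ._+_ (cong₂ ℚ._+_ 1/n₁ 1/n₂) 1/n₃ ⟨
    + 1 / n₁ ℚ.+ + 1 / n₂ ℚ.+ + 1 / n₃         ∎
    where open ≡-Reasoning

gcd[m,gcd[n,1]]≡1 : ∀ m n → gcd m (gcd n 1) ≡ 1
gcd[m,gcd[n,1]]≡1 m n = trans (cong (gcd m) (gcd-zeroʳ n)) (gcd-zeroʳ m)

-- The gcd divides 2, hence 2m; it also divides 2m + 1, hence 1.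
gcd[2m+1,gcd[n,2]]≡1 : ∀ m n → gcd (2 * m + 1) (gcd n 2) ≡ 1
gcd[2m+1,gcd[n,2]]≡1 m n = ∣1⇒≡1 (∣m+n∣m⇒∣n (gcd[m,n]∣m (2 * m + 1) (gcd n 2)) g∣2m)
  where
  g∣2m : gcd (2 * m + 1) (gcd n 2) ∣ 2 * m
  g∣2m = ∣m⇒∣m*n m (∣-trans (gcd[m,n]∣n (2 * m + 1) (gcd n 2)) (gcd[m,n]∣n n 2))

withSolution : ∀ {m n₁ n₂ n₃} → WildSolution m n₁ n₂ n₃ →
               ErdősStraus m n₁ n₂ n₃ × WildSolution m n₁ n₂ n₃
withSolution w = WildSolution.solution w , w

-- With b = 10n - 1, the modulus 30n - 1 takes the form 3b + 2, which makes case (1) a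
-- subtraction-free identity within reach of the ring solver.
3[10n∸1]+2≡30n∸1 : ∀ n .{{_ : NonZero n}} → 3 * (10 * n ∸ 1) + 2 ≡ 30 * n ∸ 1
3[10n∸1]+2≡30n∸1 n = begin
  3 * b + 2              ≡⟨ m+n∸n≡m (3 * b + 2) 1 ⟨
  3 * b + 2 + 1 ∸ 1      ≡⟨ cong (_∸ 1) (collect b) ⟩
  3 * (b + 1) ∸ 1        ≡⟨ cong (λ x → 3 * x ∸ 1) (m∸n+n≡m (*-mono-≤ (m≤m+n 1 9) (>-nonZero⁻¹ n))) ⟩
  3 * (10 * n) ∸ 1       ≡⟨ cong (_∸ 1) (*-assoc 3 10 n) ⟨
  30 * n ∸ 1             ∎
  where
  open ≡-Reasoning
  b : ℕ
  b = 10 * n ∸ 1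
  collect : ∀ b → 3 * b + 2 + 1 ≡ 3 * (b + 1)
  collect = solve-∀

-- For b = 10ℓ - 1 and a = 3b + 2 one has 6b + 4 = 2a, and the term in c adds 6ca.
factor₁ : ∀ ℓ c .{{_ : NonZero ℓ}} →
          6 * ((10 * ℓ ∸ 1) + c * (30 * ℓ ∸ 1)) + 4 ≡ 2 * (3 * c + 1) * (30 * ℓ ∸ 1)
factor₁ ℓ c =
  subst (λ a → 6 * ((10 * ℓ ∸ 1) + c * a) + 4 ≡ 2 * (3 * c + 1) * a)
    (3[10n∸1]+2≡30n∸1 ℓ) (identity (10 * ℓ ∸ 1) c)
  where
  identity : ∀ b c → 6 * (b + c * (3 * b + 2)) + 4 ≡ 2 * (3 * c + 1) * (3 * b + 2)
  identity = solve-∀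

-- Here 6 (10ℓ + 4) + 4 = 4a with a = 15ℓ + 7, and the term in c adds 6ca; the same happens in
-- `factor₃` with a = 30ℓ + 13.
factor₂ : ∀ ℓ c → 6 * (10 * ℓ + 4 + c * (15 * ℓ + 7)) + 4 ≡ 2 * (3 * c + 2) * (15 * ℓ + 7)
factor₂ = solve-∀

factor₃ : ∀ ℓ c → 6 * (20 * ℓ + 8 + c * (30 * ℓ + 13)) + 4 ≡ 2 * (3 * c + 2) * (30 * ℓ + 13)
factor₃ = solve-∀

theorem3p4 : ∀ (m : ℕ) .{{_ : NonZero m}} →
  -- (1); as ℓ is positive, neither subtraction is truncated
  (∀ (ℓ c : ℕ) .{{_ : NonZero ℓ}} →
     m ≡ (10 * ℓ ∸ 1) + c * (30 * ℓ ∸ 1) →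
     let n₁ = 6 * m + 4
         n₂ = 4 * ℓ * (3 * c + 1) * (24 * m + 1)
         n₃ = 4 * ℓ * (3 * c + 1) * (30 * ℓ ∸ 1) * (24 * m + 1)
     in ErdősStraus m n₁ n₂ n₃ × WildSolution m n₁ n₂ n₃)
  ×
  -- (2)
  (∀ (ℓ c : ℕ) .{{_ : NonZero ℓ}} →
     m ≡ 10 * ℓ + 4 + c * (15 * ℓ + 7) →
     let n₁ = 6 * m + 4
         n₂ = (2 * ℓ + 1) * (3 * c + 2) * (24 * m + 1)
         n₃ = 2 * (2 * ℓ + 1) * (3 * c + 2) * (15 * ℓ + 7) * (24 * m + 1)
     in ErdősStraus m n₁ n₂ n₃ × WildSolution m n₁ n₂ n₃)
  ×
  -- (3)
  (∀ (ℓ c : ℕ) .{{_ : NonZero ℓ}} →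
     m ≡ 20 * ℓ + 8 + c * (30 * ℓ + 13) →
     let n₁ = 6 * m + 4
         n₂ = 2 * (2 * ℓ + 1) * (3 * c + 2) * (24 * m + 1)
         n₃ = (2 * ℓ + 1) * (3 * c + 2) * (30 * ℓ + 13) * (24 * m + 1)
     in ErdősStraus m n₁ n₂ n₃ × WildSolution m n₁ n₂ n₃)
theorem3p4 m =
    (λ ℓ c {{ℓ≢0}} m≡ →
      let a = 30 * ℓ ∸ 1
          1≤30ℓ = *-mono-≤ (m≤m+n 1 29) (1≤ ℓ)
      in withSolution (wildSolution m 4 (2 * ℓ) a 1 (4 * ℓ * (3 * c + 1)) (4 * ℓ * (3 * c + 1) * a)
           (s≤s z≤n) 4≤12m (*-monoʳ-≤ 2 (1≤ ℓ))
           -- Lowering 2 ≤ 30ℓ by one gives 1 ≤ `a`.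
           (∸-monoˡ-≤ 1 (*-mono-≤ (m≤m+n 2 28) (1≤ ℓ))) (s≤s z≤n)
           (trans (m∸n+n≡m 1≤30ℓ) (sum₁ ℓ)) (gcd[m,gcd[n,1]]≡1 (2 * ℓ) a)
           (trans (cong (2 * ℓ *_) (n₁≡ m≡ (factor₁ ℓ c))) (J₁A₂₁ ℓ (3 * c + 1) a))
           (trans (cong (2 * ℓ *_) (n₁≡ m≡ (factor₁ ℓ c))) (J₂A₃₁ ℓ (3 * c + 1) a))))
  , (λ ℓ c {{ℓ≢0}} m≡ →
      let b = 2 * ℓ + 1
          a = 15 * ℓ + 7
      in withSolution (wildSolution m 4 b (2 * a) 1 (b * (3 * c + 2)) (2 * b * (3 * c + 2) * a)
           (s≤s z≤n) 4≤12m (2≤2ℓ+1 ℓ)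
           (*-mono-≤ (m≤m+n 1 1) (≤-trans (m≤m+n 1 6) (m≤n+m 7 (15 * ℓ)))) (s≤s z≤n)
           (sum₂ ℓ) (gcd[m,gcd[n,1]]≡1 b (2 * a))
           (trans (cong (b *_) (n₁≡ m≡ (factor₂ ℓ c))) (J₁A₂₂ b (3 * c + 2) a))
           (trans (cong (b *_) (n₁≡ m≡ (factor₂ ℓ c))) (J₂A₃₂ b (3 * c + 2) a))))
  , (λ ℓ c {{ℓ≢0}} m≡ →
      let b = 2 * ℓ + 1
          a = 30 * ℓ + 13
      in withSolution (wildSolution m 4 b a 2 (2 * b * (3 * c + 2)) (b * (3 * c + 2) * a)
           (s≤s z≤n) 4≤12m (2≤2ℓ+1 ℓ)
           (≤-trans (m≤m+n 1 12) (m≤n+m 13 (30 * ℓ))) (s≤s z≤n)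
           -- Now `J₂` is 2, so coprimality rests on the multiplier 2ℓ + 1 being odd.
           (sum₃ ℓ) (gcd[2m+1,gcd[n,2]]≡1 ℓ a)
           (trans (cong (b *_) (n₁≡ m≡ (factor₃ ℓ c))) (J₁A₂₃ b (3 * c + 2) a))
           (trans (cong (b *_) (n₁≡ m≡ (factor₃ ℓ c))) (J₂A₃₃ b (3 * c + 2) a))))
  where
  1≤ : ∀ n .{{_ : NonZero n}} → 1 ≤ n
  1≤ n = >-nonZero⁻¹ n

  4≤12m : 4 ≤ 12 * m
  4≤12m = *-mono-≤ (m≤m+n 4 8) (1≤ m)

  2≤2ℓ+1 : ∀ ℓ .{{_ : NonZero ℓ}} → 2 ≤ 2 * ℓ + 1
  2≤2ℓ+1 ℓ = ≤-trans (*-monoʳ-≤ 2 (1≤ ℓ)) (m≤m+n (2 * ℓ) 1)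

  n₁≡ : ∀ {x y} → m ≡ x → 6 * x + 4 ≡ y → 6 * m + 4 ≡ y
  n₁≡ m≡x eq = trans (cong (λ x → 6 * x + 4) m≡x) eq

  -- The factor 15 is 4k - 1 at k = 4.
  sum₁ : ∀ ℓ → 30 * ℓ ≡ 2 * ℓ * 15
  sum₁ = solve-∀
  -- In this and the similar identities below, `d` stands for 3c + 1 in case (1) and for 3c + 2 in
  -- the others, and 2da is the factored form of 6m + 4.
  J₁A₂₁ : ∀ ℓ d a → 2 * ℓ * (2 * d * a) ≡ a * (4 * ℓ * d)
  J₁A₂₁ = solve-∀
  J₂A₃₁ : ∀ ℓ d a → 2 * ℓ * (2 * d * a) ≡ 1 * (4 * ℓ * d * a)
  J₂A₃₁ = solve-∀

  sum₂ : ∀ ℓ → 2 * (15 * ℓ + 7) + 1 ≡ (2 * ℓ + 1) * 15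
  sum₂ = solve-∀
  J₁A₂₂ : ∀ b d a → b * (2 * d * a) ≡ 2 * a * (b * d)
  J₁A₂₂ = solve-∀
  J₂A₃₂ : ∀ b d a → b * (2 * d * a) ≡ 1 * (2 * b * d * a)
  J₂A₃₂ = solve-∀

  sum₃ : ∀ ℓ → 30 * ℓ + 13 + 2 ≡ (2 * ℓ + 1) * 15
  sum₃ = solve-∀
  J₁A₂₃ : ∀ b d a → b * (2 * d * a) ≡ a * (2 * b * d)
  J₁A₂₃ = solve-∀
  J₂A₃₃ : ∀ b d a → b * (2 * d * a) ≡ 2 * (b * d * a)
  J₂A₃₃ = solve-∀
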